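{- Let $(G,\mathcal{C})$ be a 2-colored graph, $G=(V,E)$, and let $l,u:E\to\mathbb{N}$ satisfy $l(e)\le u(e)$ for all $e\in E$. If there exists a rational vector $x\in\mathcal{A}(G,\mathcal{C})$ with $l(e)\le x(e)\le u(e)$ for all $e\in E$, then there exists an integral vector $y\in\mathcal{A}(G,\mathcal{C})$ with $2l(e)\le y(e)\le 2u(e)$ for all $e\in E$.
   Context: Graphs are finite, undirected, may have parallel edges but no loops; $\mathcal{C}:E\to\{R,B\}$ is a red/blue edge coloring. The alternating cone $\mathcal{A}(G,\mathcal{C})\subseteq\mathbb{R}^E$ is the set of $x$ with $x(e)\ge0$ for all $e$ and, at every vertex $v$, the sum of $x(e)$ over red edges at $v$ equals the sum of $x(e)$ over blue edges at $v$. -}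

module Defs where

open import Algebra.Properties.CommutativeMonoid.Sum using (sum)
open import Data.Bool.Base using (if_then_else_)
open import Data.Fin.Base using (Fin)
open import Data.Fin.Properties using (_≟_)
open import Data.Integer.Base using (ℤ; +_)
open import Data.Nat.Base using (ℕ)
open import Data.Product.Base using (_×_; ∃)
open import Data.Rational.Base using (ℚ; 0ℚ; _≤_; _/_)
open import Data.Rational.Properties using (+-0-commutativeMonoid)
open import Data.Sum.Base using (_⊎_)
open import Level using (0ℓ)
open import Relation.Binary.Definitions using (DecidableEquality)
open import Relation.Binary.PropositionalEquality.Core using (_≡_; _≢_; refl)
open import Relation.Nullary.Decidable using (Dec; yes; no; does; _×-dec_; _⊎-dec_)
open import Relation.Unary using (Pred)

-- Finite loopless multigraphs. Edges have their own identity, so parallel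
-- edges are allowed. The order of the two ends of an edge carries no meaning:
-- the graph is used only through the symmetric relation `Incident`.
record Graph : Set where
  field
    ∣V∣ ∣E∣ : ℕ

  V = Fin ∣V∣
  E = Fin ∣E∣

  field
    end₁ end₂ : E → V
    loopless  : ∀ e → end₁ e ≢ end₂ e

  Incident : V → E → Set
  Incident v e = v ≡ end₁ e ⊎ v ≡ end₂ e

  incident? : ∀ v e → Dec (Incident v e)
  incident? v e = (v ≟ end₁ e) ⊎-dec (v ≟ end₂ e)

open Graph public using (V; E)

data Colour : Set where
  red blue : Colour

_≟ᶜ_ : DecidableEquality Colour
red  ≟ᶜ red  = yes refl
red  ≟ᶜ blue = no λ ()
blue ≟ᶜ red  = no λ ()
blue ≟ᶜ blue = yes refl

Colouring : Graph → Set
Colouring G = E G → Colour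

module _ (G : Graph) (𝒞 : Colouring G) where

  open Graph G using (incident?)

  colourDegree : Colour → (E G → ℚ) → V G → ℚ
  colourDegree c x v = sum +-0-commutativeMonoid λ e →
    if does (incident? v e ×-dec (𝒞 e ≟ᶜ c)) then x e else 0ℚ

  -- The rational points of the alternating cone.
  AlternatingCone : Pred (E G → ℚ) 0ℓ
  AlternatingCone x =
    (∀ e → 0ℚ ≤ x e) ×
    (∀ v → colourDegree red x v ≡ colourDegree blue x v)

fromℕ : ℕ → ℚ
fromℕ n = + n / 1

Integral : ∀ {A : Set} → Pred (A → ℚ) 0ℓ
Integral x = ∀ a → ∃ λ (z : ℤ) → x a ≡ z / 1

{-# OPTIONS --safe #-}
module Submission where

-- In the bipartite double cover every vertex v has a red and a blue copy, and
-- an edge ab becomes two arcs, from a to b and from b to a, each running from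
-- the copies of the colour opposite to the edge to those of its own colour.
-- Alternating vectors lift to circulations, and adding the two arc values of
-- an integral circulation within the bounds l, u gives an integral alternating
-- vector within 2l, 2u. It remains to round a rational circulation g to an
-- integral one. Start from f = 0 and repeatedly augment f along a cycle through
-- an arc with f < l, using an arc forwards only where f < g and backwards only
-- where f > g. Then f ≤ u is preserved and no shortage l ∸ f increases. The
-- cycle exists, since otherwise the vertices reachable from the head of the arc
-- form a cut on which the circulations f and g disagree.

open import Algebra.Bundles using (CommutativeMonoid; CommutativeRing)
open import Algebra.Properties.CommutativeMonoid.Sum as Sum using ()
import Algebra.Properties.Semiring.Sum as SemiringSum
open import Data.Bool.Base using (if_then_else_)
open import Data.Empty using (⊥-elim)
open import Data.Fin.Base using (Fin; zero; suc; _↑ˡ_; _↑ʳ_; splitAt)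
open import Data.Fin.Properties using (_≟_; any?; splitAt-↑ˡ; splitAt-↑ʳ; suc-injective)
open import Data.Fin.Subset as Subset using (Subset; _∪_; ⁅_⁆; _⊃_)
open import Data.Fin.Subset.Induction using (⊃-wellFounded)
open import Data.Fin.Subset.Properties
  using (_∈?_; p⊆p∪q; q⊆p∪q; x∈p∪q⁻; x∈⁅x⁆; x∈⁅y⁆⇒x≡y)
import Data.Integer.Base as ℤ
import Data.Integer.Properties as ℤ
open import Data.Nat.Base as ℕ using (ℕ; zero; suc; pred; _∸_; z≤n)
import Data.Nat.Induction as ℕ
import Data.Nat.Properties as ℕ
open import Data.Product.Base using (_×_; ∃; _,_; proj₁; proj₂)
open import Data.Rational.Base
  using (ℚ; 0ℚ; 1ℚ; _+_; _*_; _-_; -_; _≤_; _<_; toℚᵘ)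
open import Data.Rational.Properties as ℚ using (+-0-commutativeMonoid)
open import Data.Rational.Solver using (module +-*-Solver)
open import Data.Rational.Unnormalised.Base as ℚᵘ using (mkℚᵘ; *≡*; *≤*)
import Data.Rational.Unnormalised.Properties as ℚᵘ
open import Data.Sum.Base using (_⊎_; inj₁; inj₂; [_,_]′)
open import Data.Vec.Functional using (updateAt)
open import Data.Vec.Functional.Properties using (updateAt-updates; updateAt-minimal)
open import Defs
open import Function.Base using (_∘_; const; id)
open import Induction.WellFounded using (Acc; acc)
open import Relation.Binary.Core using (Rel)
open import Relation.Binary.PropositionalEquality
  using (_≡_; _≢_; refl; sym; trans; cong; cong₂; subst; module ≡-Reasoning)
open import Relation.Nullary.Decidable using (Dec; yes; no; does; map′; ¬?; _×-dec_; _⊎-dec_)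
open import Relation.Nullary.Negation using (¬_; contradiction)
open import Relation.Unary using (_∈_)

open Sum +-0-commutativeMonoid using (sum; sum-cong-≗; ∑-distrib-+; ∑-comm)
open SemiringSum (CommutativeRing.semiring ℚ.+-*-commutativeRing) using (*-distribˡ-sum)
open +-*-Solver using (solve; con; _:+_; _:*_; _:-_; :-_; _:=_)

-- Sums

module _ {c ℓ} (M : CommutativeMonoid c ℓ) where

  open CommutativeMonoid M using (Carrier; _∙_)

  -- Kept generic because it serves twice: in ℕ for the decrease of the total shortage, in ℚ for
  -- comparing two circulations across a cut.
  module OrderedSum {r₁ r₂} (_≲_ : Rel Carrier r₁) (_≺_ : Rel Carrier r₂)
    (≲-refl : ∀ {x} → x ≲ x)
    (mono-≲ : ∀ {x y u v} → x ≲ y → u ≲ v → (x ∙ u) ≲ (y ∙ v))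
    (mono-≺-≲ : ∀ {x y u v} → x ≺ y → u ≲ v → (x ∙ u) ≺ (y ∙ v))
    (mono-≲-≺ : ∀ {x y u v} → x ≲ y → u ≺ v → (x ∙ u) ≺ (y ∙ v))
    where

    sum-mono-≲ : ∀ {n} {f g : Fin n → Carrier} →
      (∀ k → f k ≲ g k) → Sum.sum M f ≲ Sum.sum M g
    sum-mono-≲ {zero}  f≲g = ≲-refl
    sum-mono-≲ {suc n} f≲g = mono-≲ (f≲g zero) (sum-mono-≲ (f≲g ∘ suc))

    sum-mono-≺ : ∀ {n} {f g : Fin n → Carrier} →
      (∀ k → f k ≲ g k) → ∀ e → f e ≺ g e → Sum.sum M f ≺ Sum.sum M g
    sum-mono-≺ f≲g zero    fe≺ge = mono-≺-≲ fe≺ge (sum-mono-≲ (f≲g ∘ suc))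
    sum-mono-≺ f≲g (suc e) fe≺ge = mono-≲-≺ (f≲g zero) (sum-mono-≺ (f≲g ∘ suc) e fe≺ge)

sumℕ : ∀ {n} → (Fin n → ℕ) → ℕ
sumℕ = Sum.sum ℕ.+-0-commutativeMonoid

sumℕ-mono-< : ∀ {n} {f g : Fin n → ℕ} →
  (∀ k → f k ℕ.≤ g k) → ∀ e → f e ℕ.< g e → sumℕ f ℕ.< sumℕ g
sumℕ-mono-< = OrderedSum.sum-mono-≺ ℕ.+-0-commutativeMonoid ℕ._≤_ ℕ._<_
  ℕ.≤-refl ℕ.+-mono-≤ ℕ.+-mono-<-≤ ℕ.+-mono-≤-<

sum-mono-< : ∀ {n} {f g : Fin n → ℚ} →
  (∀ k → f k ≤ g k) → ∀ e → f e < g e → sum f < sum g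
sum-mono-< = OrderedSum.sum-mono-≺ +-0-commutativeMonoid _≤_ _<_
  ℚ.≤-refl ℚ.+-mono-≤ ℚ.+-mono-<-≤ ℚ.+-mono-≤-<

sum-zero : ∀ {n} {f : Fin n → ℚ} → (∀ k → f k ≡ 0ℚ) → sum f ≡ 0ℚ
sum-zero {n} f≡0 = trans (sum-cong-≗ f≡0) (Sum.sum-replicate-zero +-0-commutativeMonoid n)

sum-↑ : ∀ m {n} (f : Fin (m ℕ.+ n) → ℚ) →
  sum f ≡ sum (λ k → f (k ↑ˡ n)) + sum (λ k → f (m ↑ʳ k))
sum-↑ zero    f = sym (ℚ.+-identityˡ _)
sum-↑ (suc m) f = trans (cong (f zero +_) (sum-↑ m (f ∘ suc))) (sym (ℚ.+-assoc (f zero) _ _))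

sum-change : ∀ {n} (f g : Fin n → ℚ) k → (∀ j → j ≢ k → g j ≡ f j) →
  sum g ≡ sum f + (g k - f k)
sum-change f g zero    eq = trans
  (cong (g zero +_) (sum-cong-≗ λ j → eq (suc j) λ ()))
  (solve 3 (λ a b s → a :+ s := (b :+ s) :+ (a :- b)) refl (g zero) (f zero) _)
sum-change f g (suc k) eq = trans
  (cong₂ _+_ (eq zero λ ())
    (sum-change (f ∘ suc) (g ∘ suc) k λ j j≢k → eq (suc j) (j≢k ∘ suc-injective)))
  (sym (ℚ.+-assoc (f zero) _ _))

-- Decided by the same test `v ≟ w` as `incident?`, so that one case split evaluates both.
δ : ∀ {n} → Fin n → Fin n → ℚ
δ v w = if does (v ≟ w) then 1ℚ else 0ℚ

δ-refl : ∀ {n} (v : Fin n) → δ v v ≡ 1ℚ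
δ-refl v with v ≟ v
... | yes _   = refl
... | no  v≢v = contradiction refl v≢v

δ-≢ : ∀ {n} {v w : Fin n} → v ≢ w → δ v w ≡ 0ℚ
δ-≢ {v = v} {w} v≢w with v ≟ w
... | yes v≡w = contradiction v≡w v≢w
... | no  _   = refl

sum-δ : ∀ {n} (f : Fin n → ℚ) w → sum (λ v → f v * δ v w) ≡ f w
sum-δ {n} f w = begin
  sum (λ v → f v * δ v w)            ≡⟨ sum-change (const 0ℚ) _ w off ⟩
  sum {n} (const 0ℚ) + (f w * δ w w - 0ℚ)
    ≡⟨ cong₂ (λ s d → s + (f w * d - 0ℚ)) (sum-zero {n} λ _ → refl) (δ-refl w) ⟩
  0ℚ + (f w * 1ℚ - 0ℚ)
    ≡⟨ solve 1 (λ a → con 0ℚ :+ (a :* con 1ℚ :- con 0ℚ) := a) refl (f w) ⟩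
  f w                                ∎
  where
  open ≡-Reasoning
  off : ∀ v → v ≢ w → f v * δ v w ≡ 0ℚ
  off v v≢w = trans (cong (f v *_) (δ-≢ v≢w)) (ℚ.*-zeroʳ (f v))

-- The embedding of the natural numbers

-- In unnormalised form the denominator is literally 1, so sums and comparisons reduce to integer
-- arithmetic.
toℚᵘ-fromℕ : ∀ n → toℚᵘ (fromℕ n) ℚᵘ.≃ mkℚᵘ (ℤ.+ n) 0
toℚᵘ-fromℕ n = ℚ.toℚᵘ-fromℚᵘ (mkℚᵘ (ℤ.+ n) 0)

fromℕ-+ : ∀ m n → fromℕ (m ℕ.+ n) ≡ fromℕ m + fromℕ n
fromℕ-+ m n = ℚ.toℚᵘ-injective (begin
  toℚᵘ (fromℕ (m ℕ.+ n))               ≈⟨ toℚᵘ-fromℕ (m ℕ.+ n) ⟩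
  mkℚᵘ (ℤ.+ (m ℕ.+ n)) 0                 ≈⟨ *≡* (cong (ℤ._* ℤ.+ 1) (sym
    (cong₂ ℤ._+_ (ℤ.*-identityʳ (ℤ.+ m)) (ℤ.*-identityʳ (ℤ.+ n))))) ⟩
  mkℚᵘ (ℤ.+ m) 0 ℚᵘ.+ mkℚᵘ (ℤ.+ n) 0       ≈⟨ ℚᵘ.+-cong (toℚᵘ-fromℕ m) (toℚᵘ-fromℕ n) ⟨
  toℚᵘ (fromℕ m) ℚᵘ.+ toℚᵘ (fromℕ n)   ≈⟨ ℚ.toℚᵘ-homo-+ (fromℕ m) (fromℕ n) ⟨
  toℚᵘ (fromℕ m + fromℕ n)             ∎)
  where open ℚᵘ.≃-Reasoning

fromℕ-mono-≤ : ∀ {m n} → m ℕ.≤ n → fromℕ m ≤ fromℕ n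
fromℕ-mono-≤ {m} {n} m≤n = ℚ.toℚᵘ-cancel-≤ (begin
  toℚᵘ (fromℕ m)  ≃⟨ toℚᵘ-fromℕ m ⟩
  mkℚᵘ (ℤ.+ m) 0    ≤⟨ *≤* (ℤ.*-monoʳ-≤-nonNeg (ℤ.+ 1) (ℤ.+≤+ m≤n)) ⟩
  mkℚᵘ (ℤ.+ n) 0    ≃⟨ toℚᵘ-fromℕ n ⟨
  toℚᵘ (fromℕ n)  ∎)
  where open ℚᵘ.≤-Reasoning

fromℕ-cancel-< : ∀ m n → fromℕ m < fromℕ n → m ℕ.< n
fromℕ-cancel-< m n m<n = ℕ.≰⇒> λ n≤m → ℚ.<-irrefl refl (ℚ.<-≤-trans m<n (fromℕ-mono-≤ n≤m))

fromℕ-mono-< : ∀ {m n} → m ℕ.< n → fromℕ m < fromℕ n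
fromℕ-mono-< {m} {n} m<n = ℚ.<-≤-trans
  (ℚ.<-respʳ-≡ (sym (fromℕ-+ 1 m)) (ℚ.<-respˡ-≡ (ℚ.+-identityˡ (fromℕ m))
    (ℚ.+-monoˡ-< (fromℕ m) (ℚ.positive⁻¹ 1ℚ))))
  (fromℕ-mono-≤ m<n)

-- Rounding circulations

-- One unit towards q, possibly past it.
data _⊢_⇝_ (q : ℚ) : ℕ → ℕ → Set where
  stay : ∀ {n} → q ⊢ n ⇝ n
  up   : ∀ {n} → fromℕ n < q → q ⊢ n ⇝ suc n
  down : ∀ {n} → q < fromℕ (suc n) → q ⊢ suc n ⇝ n

down-pred : ∀ {q n} → 0ℚ ≤ q → q < fromℕ n → q ⊢ n ⇝ pred n
down-pred {n = zero}  0≤q q<0 = ⊥-elim (ℚ.<-irrefl refl (ℚ.<-≤-trans q<0 0≤q))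
down-pred {n = suc n} 0≤q q<n = down q<n

-- Overshooting `q` is harmless because `u` is an integer: `n < q ≤ u` already gives `suc n ≤ u`.
⇝-≤ : ∀ {q n n′ u} → q ≤ fromℕ u → n ℕ.≤ u → q ⊢ n ⇝ n′ → n′ ℕ.≤ u
⇝-≤ q≤u n≤u stay     = n≤u
⇝-≤ q≤u n≤u (up {n} n<q) = fromℕ-cancel-< n _ (ℚ.<-≤-trans n<q q≤u)
⇝-≤ q≤u n≤u (down _) = ℕ.≤-trans (ℕ.n≤1+n _) n≤u

-- Only a downward step could hurt, but `l ≤ q < suc n` forces `l ≤ n`, so the shortage after it is
-- zero.
⇝-∸ : ∀ {q n n′ l} → fromℕ l ≤ q → q ⊢ n ⇝ n′ → l ∸ n′ ℕ.≤ l ∸ n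
⇝-∸         l≤q stay         = ℕ.≤-refl
⇝-∸ {l = l} l≤q (up _)       = ℕ.∸-monoʳ-≤ l (ℕ.n≤1+n _)
⇝-∸ {l = l} l≤q (down {n} q<1+n) =
  ℕ.≤-trans (ℕ.≤-reflexive (ℕ.m≤n⇒m∸n≡0
    (ℕ.<⇒≤pred (fromℕ-cancel-< l (suc n) (ℚ.≤-<-trans l≤q q<1+n))))) z≤n

fromℕ-suc : ∀ n → fromℕ (suc n) ≡ fromℕ n + 1ℚ
fromℕ-suc n = trans (fromℕ-+ 1 n) (ℚ.+-comm 1ℚ (fromℕ n))

fromℕ-pred : ∀ n → 0ℚ < fromℕ n → fromℕ (pred n) ≡ fromℕ n - 1ℚ
fromℕ-pred zero    0<0 = contradiction 0<0 (ℚ.<-irrefl refl)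
fromℕ-pred (suc n) _   = trans
  (solve 1 (λ a → a := (a :+ con 1ℚ) :- con 1ℚ) refl (fromℕ n))
  (cong (_- 1ℚ) (sym (fromℕ-suc n)))

module Digraph {p m} (tail head : Fin m → Fin p) where

  -- Summation by parts: this is the sum over v of π v times the net inflow of
  -- h at v, so that cuts are the case where π is the indicator of a vertex set.
  ⟪_,_⟫ : (Fin m → ℚ) → (Fin p → ℚ) → ℚ
  ⟪ h , π ⟫ = sum λ k → h k * (π (head k) - π (tail k))

  -- Quantifying over all potentials, instead of asking for balance at each vertex, lets `χ S` and
  -- the signed potentials of the double cover be substituted directly.
  Circulation : (Fin m → ℚ) → Set
  Circulation h = ∀ π → ⟪ h , π ⟫ ≡ 0ℚ

  module Rounding (g : Fin m → ℚ) (0≤g : ∀ k → 0ℚ ≤ g k) (g-circ : Circulation g) where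

    _↝_ : (f f′ : Fin m → ℕ) → Set
    f ↝ f′ = ∀ k → g k ⊢ f k ⇝ f′ k

    module Augment (f : Fin m → ℕ) (f-circ : Circulation (fromℕ ∘ f))
      (e : Fin m) (fe<ge : fromℕ (f e) < g e) where

      -- Residual arcs of `f`, with `g` as the barrier in both directions. The last index is the
      -- value that arc `k` takes once the arrow is used.
      data Arrow (k : Fin m) : Fin p → Fin p → ℕ → Set where
        forward  : fromℕ (f k) < g k → Arrow k (tail k) (head k) (suc (f k))
        backward : g k < fromℕ (f k) → Arrow k (head k) (tail k) (pred (f k))

      arrow-⇝ : ∀ {k v w n} → Arrow k v w n → g k ⊢ f k ⇝ n
      arrow-⇝ {k} (forward f<g)  = up f<g
      arrow-⇝ {k} (backward g<f) = down-pred (0≤g k) g<f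

      arrow-change : ∀ {k v w n} → Arrow k v w n → ∀ (π : Fin p → ℚ) →
        let d = π (head k) - π (tail k) in
        fromℕ n * d - fromℕ (f k) * d ≡ π w - π v
      arrow-change {k} (forward _) π = trans
        (cong (λ a → a * d - fromℕ (f k) * d) (fromℕ-suc (f k)))
        (solve 2 (λ a d → (a :+ con 1ℚ) :* d :- a :* d := d) refl (fromℕ (f k)) d)
        where d = π (head k) - π (tail k)
      arrow-change {k} (backward g<f) π = trans
        (cong (λ a → a * d - fromℕ (f k) * d) (fromℕ-pred (f k) (ℚ.≤-<-trans (0≤g k) g<f)))
        (solve 3 (λ a h t → (a :- con 1ℚ) :* (h :- t) :- a :* (h :- t) := t :- h) refl
          (fromℕ (f k)) (π (head k)) (π (tail k)))
        where d = π (head k) - π (tail k)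

      -- Dual form of carrying one extra unit from `head e` to `v`: net inflow 1 at `v` and -1 at
      -- `head e`. For `v` equal to `head e` this is conservation.
      Excess : Fin p → (Fin m → ℕ) → Set
      Excess v f′ = ∀ π → ⟪ fromℕ ∘ f′ , π ⟫ ≡ π v - π (head e)

      module _ {f′ : Fin m → ℕ} {k v w n} (a : Arrow k v w n) (f′k≡fk : f′ k ≡ f k) where

        push : Fin m → ℕ
        push = updateAt f′ k (const n)

        push-≡ : push k ≡ n
        push-≡ = updateAt-updates k f′

        push-≢ : ∀ j → j ≢ k → push j ≡ f′ j
        push-≢ j = updateAt-minimal j k f′

        push-↝ : f ↝ f′ → f ↝ push
        push-↝ f↝f′ j with j ≟ k
        ... | yes refl = subst (g j ⊢ f j ⇝_) (sym push-≡) (arrow-⇝ a)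
        ... | no  j≢k  = subst (g j ⊢ f j ⇝_) (sym (push-≢ j j≢k)) (f↝f′ j)

        push-excess : Excess v f′ → Excess w push
        push-excess ex π = begin
          ⟪ fromℕ ∘ push , π ⟫
            ≡⟨ sum-change _ _ k (λ j j≢k → cong (λ x → fromℕ x * d j) (push-≢ j j≢k)) ⟩
          ⟪ fromℕ ∘ f′ , π ⟫ + (fromℕ (push k) * d k - fromℕ (f′ k) * d k)
            ≡⟨ cong₂ _+_ (ex π) (cong₂ (λ x y → fromℕ x * d k - fromℕ y * d k) push-≡ f′k≡fk) ⟩
          (π v - π (head e)) + (fromℕ n * d k - fromℕ (f k) * d k)
            ≡⟨ cong (λ x → (π v - π (head e)) + x) (arrow-change a π) ⟩
          (π v - π (head e)) + (π w - π v)
            ≡⟨ solve 3 (λ v w h → (v :- h) :+ (w :- v) := w :- h) refl (π v) (π w) (π (head e)) ⟩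
          π w - π (head e) ∎
          where
          open ≡-Reasoning
          d : Fin m → ℚ
          d j = π (head j) - π (tail j)

      Outside : Subset p → Fin m → Set
      Outside S k = k ≡ e ⊎ tail k Subset.∉ S ⊎ head k Subset.∉ S

      -- Since only arcs inside S are modified, and never e, an arc leaving S
      -- can be pushed on top of f′ exactly as on top of f. This replaces any
      -- bookkeeping of simple paths.
      record Reached (S : Subset p) (v : Fin p) : Set where
        field
          f′        : Fin m → ℕ
          f↝f′      : f ↝ f′
          excess    : Excess v f′
          unchanged : ∀ k → Outside S k → f′ k ≡ f k

      reached-source : Reached ⁅ head e ⁆ (head e)
      reached-source = record
        { f′        = f
        ; f↝f′      = λ _ → stay
        ; excess    = λ π → trans (f-circ π) (sym (ℚ.+-inverseʳ (π (head e))))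
        ; unchanged = λ _ _ → refl
        }

      reached-⊆ : ∀ {S T v} → S Subset.⊆ T → Reached S v → Reached T v
      reached-⊆ S⊆T r = record
        { f′        = f′
        ; f↝f′      = f↝f′
        ; excess    = excess
        ; unchanged = λ where
            k (inj₁ k≡e)        → unchanged k (inj₁ k≡e)
            k (inj₂ (inj₁ t∉T)) → unchanged k (inj₂ (inj₁ (t∉T ∘ S⊆T)))
            k (inj₂ (inj₂ h∉T)) → unchanged k (inj₂ (inj₂ (h∉T ∘ S⊆T)))
        }
        where open Reached r

      Leaving : Subset p → Fin m → Set
      Leaving S k = ∃ λ v → ∃ λ w → v Subset.∈ S × w Subset.∉ S × ∃ (Arrow k v w)

      leaving? : ∀ S k → Dec (Leaving S k)
      leaving? S k = map′
        [ (λ (t∈S , h∉S , f<g) → _ , _ , t∈S , h∉S , _ , forward f<g)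
        , (λ (h∈S , t∉S , g<f) → _ , _ , h∈S , t∉S , _ , backward g<f) ]′
        (λ where
          (_ , _ , t∈S , h∉S , _ , forward f<g)  → inj₁ (t∈S , h∉S , f<g)
          (_ , _ , h∈S , t∉S , _ , backward g<f) → inj₂ (h∈S , t∉S , g<f))
        ((tail k ∈? S ×-dec ¬? (head k ∈? S) ×-dec fromℕ (f k) ℚ.<? g k) ⊎-dec
         (head k ∈? S ×-dec ¬? (tail k ∈? S) ×-dec g k ℚ.<? fromℕ (f k)))

      χ : Subset p → Fin p → ℚ
      χ S v = if does (v ∈? S) then 1ℚ else 0ℚ

      -- Both circulations pair to zero with the indicator of `S`. If no arrow leaves `S`, then
      -- `f ≤ g` on arcs entering `S` and `f ≥ g` on arcs leaving it, so the pairing of `f` is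
      -- termwise at most that of `g`. It is strictly smaller at `e`, which enters `S`.
      cut : ∀ S → head e Subset.∈ S → tail e Subset.∉ S → ¬ (∀ k → ¬ Leaving S k)
      cut S h∈S t∉S closed = ℚ.<-irrefl
        (trans (f-circ (χ S)) (sym (g-circ (χ S))))
        (sum-mono-< below e strict)
        where
        below : ∀ k → fromℕ (f k) * (χ S (head k) - χ S (tail k)) ≤
                      g k * (χ S (head k) - χ S (tail k))
        below k with head k ∈? S | tail k ∈? S | closed k
        ... | yes _ | yes _ | _ = ℚ.≤-reflexive
          (trans (ℚ.*-zeroʳ (fromℕ (f k))) (sym (ℚ.*-zeroʳ (g k))))
        ... | no _  | no _  | _ = ℚ.≤-reflexive
          (trans (ℚ.*-zeroʳ (fromℕ (f k))) (sym (ℚ.*-zeroʳ (g k))))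
        ... | yes h∈ | no t∉ | stuck = ℚ.*-monoʳ-≤-nonNeg 1ℚ
          (ℚ.≮⇒≥ λ g<f → stuck (_ , _ , h∈ , t∉ , _ , backward g<f))
        ... | no h∉ | yes t∈ | stuck = ℚ.*-monoʳ-≤-nonPos (- 1ℚ)
          (ℚ.≮⇒≥ λ f<g → stuck (_ , _ , t∈ , h∉ , _ , forward f<g))

        strict : fromℕ (f e) * (χ S (head e) - χ S (tail e)) <
                 g e * (χ S (head e) - χ S (tail e))
        strict with head e ∈? S | tail e ∈? S
        ... | _      | yes t∈ = contradiction t∈ t∉S
        ... | no h∉  | no _   = contradiction h∈S h∉
        ... | yes _  | no _   = ℚ.*-monoˡ-<-pos 1ℚ fe<ge

      leaving⇒outside : ∀ {S k v w n} → Arrow k v w n → w Subset.∉ S → Outside S k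
      leaving⇒outside (forward _)  h∉S = inj₂ (inj₂ h∉S)
      leaving⇒outside (backward _) t∉S = inj₂ (inj₁ t∉S)

      inside⇒¬outside : ∀ {S k v w n} → Arrow k v w n →
        v Subset.∈ S → w Subset.∈ S → k ≢ e → ¬ Outside S k
      inside⇒¬outside _            _   _   k≢e (inj₁ k≡e)        = k≢e k≡e
      inside⇒¬outside (forward _)  t∈S _   _   (inj₂ (inj₁ t∉S)) = t∉S t∈S
      inside⇒¬outside (forward _)  _   h∈S _   (inj₂ (inj₂ h∉S)) = h∉S h∈S
      inside⇒¬outside (backward _) _   t∈S _   (inj₂ (inj₁ t∉S)) = t∉S t∈S
      inside⇒¬outside (backward _) h∈S _   _   (inj₂ (inj₂ h∉S)) = h∉S h∈S

      -- Used forwards, `e` would end at `head e`, which is in `S`; used backwards, it would need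
      -- `g e < f e`. So `e` is kept for closing the cycle.
      leaving⇒≢e : ∀ {S k v w n} → head e Subset.∈ S → Arrow k v w n → w Subset.∉ S → k ≢ e
      leaving⇒≢e h∈S (forward _)    h∉S refl = h∉S h∈S
      leaving⇒≢e _   (backward g<f) _   refl = ℚ.<-asym g<f fe<ge

      extend : ∀ {S k v w n} → head e Subset.∈ S → v Subset.∈ S → w Subset.∉ S →
        Arrow k v w n → Reached S v → Reached (S ∪ ⁅ w ⁆) w
      extend {S} {k} {w = w} h∈S v∈S w∉S a r = record
        { f′        = push a f′k≡fk
        ; f↝f′      = push-↝ a f′k≡fk f↝f′
        ; excess    = push-excess a f′k≡fk excess
        -- The pushed arc has both ends in the enlarged set and is not `e`, so no arc outside that
        -- set is affected.
        ; unchanged = λ j out → trans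
            (push-≢ a f′k≡fk j λ { refl → inside⇒¬outside a
              (S⊆S∪w v∈S) (q⊆p∪q S ⁅ w ⁆ (x∈⁅x⁆ w)) (leaving⇒≢e h∈S a w∉S) out })
            (Reached.unchanged (reached-⊆ S⊆S∪w r) j out)
        }
        where
        open Reached r
        S⊆S∪w : S Subset.⊆ S ∪ ⁅ w ⁆
        S⊆S∪w = p⊆p∪q ⁅ w ⁆
        f′k≡fk : f′ k ≡ f k
        f′k≡fk = unchanged k (leaving⇒outside a w∉S)

      Augmentation : Set
      Augmentation = ∃ λ f′ → f ↝ f′ × Circulation (fromℕ ∘ f′) × f′ e ≡ suc (f e)

      -- Pushing `e` itself returns the extra unit from `tail e` to `head e`, where the excess
      -- cancels.
      close : ∀ {S} → Reached S (tail e) → Augmentation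
      close r = push a f′e≡fe , push-↝ a f′e≡fe f↝f′ ,
        (λ π → trans (push-excess a f′e≡fe excess π) (ℚ.+-inverseʳ (π (head e)))) ,
        push-≡ a f′e≡fe
        where
        open Reached r
        a : Arrow e (tail e) (head e) (suc (f e))
        a = forward fe<ge
        f′e≡fe : f′ e ≡ f e
        f′e≡fe = unchanged e (inj₁ refl)

      -- Graph search from `head e`. Each round adds a new vertex, so it terminates by finiteness of
      -- the vertex set; `cut` shows that it cannot stall before reaching `tail e`.
      grow : ∀ S → Acc _⊃_ S → head e Subset.∈ S →
        (∀ v → v Subset.∈ S → Reached S v) → Augmentation
      grow S (acc rec) h∈S reached with tail e ∈? S
      ... | yes t∈S = close (reached (tail e) t∈S)
      ... | no  t∉S with any? (leaving? S)
      ...   | no  closed = contradiction (λ k leaves → closed (k , leaves)) (cut S h∈S t∉S)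
      ...   | yes (k , v , w , v∈S , w∉S , n , a) =
        grow (S ∪ ⁅ w ⁆) (rec (S⊆S∪w , w , w∈S∪w , w∉S)) (S⊆S∪w h∈S) reached′
        where
        S⊆S∪w : S Subset.⊆ S ∪ ⁅ w ⁆
        S⊆S∪w = p⊆p∪q ⁅ w ⁆
        w∈S∪w : w Subset.∈ S ∪ ⁅ w ⁆
        w∈S∪w = q⊆p∪q S ⁅ w ⁆ (x∈⁅x⁆ w)
        reached′ : ∀ x → x Subset.∈ S ∪ ⁅ w ⁆ → Reached (S ∪ ⁅ w ⁆) x
        reached′ x x∈ with x∈p∪q⁻ S ⁅ w ⁆ x∈
        ... | inj₁ x∈S = reached-⊆ S⊆S∪w (reached x x∈S)
        ... | inj₂ x∈w with x∈⁅y⁆⇒x≡y w x∈w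
        ...   | refl = extend h∈S v∈S w∉S a (reached v v∈S)

      augment : Augmentation
      augment = grow ⁅ head e ⁆ (⊃-wellFounded _) (x∈⁅x⁆ (head e)) λ v v∈ →
        subst (Reached ⁅ head e ⁆) (sym (x∈⁅y⁆⇒x≡y (head e) v∈)) reached-source

    -- Meeting the lower bounds by repeated augmentation

    module _ (l u : Fin m → ℕ)
      (l≤g : ∀ k → fromℕ (l k) ≤ g k) (g≤u : ∀ k → g k ≤ fromℕ (u k)) where

      IntegralCirculation : Set
      IntegralCirculation = ∃ λ (f : Fin m → ℕ) → Circulation (fromℕ ∘ f) ×
        (∀ k → l k ℕ.≤ f k) × (∀ k → f k ℕ.≤ u k)

      shortage : (Fin m → ℕ) → ℕ
      shortage f = sumℕ λ k → l k ∸ f k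

      fill : ∀ f → Acc ℕ._<_ (shortage f) → Circulation (fromℕ ∘ f) →
        (∀ k → f k ℕ.≤ u k) → IntegralCirculation
      fill f (acc rec) f-circ f≤u with any? (λ k → f k ℕ.<? l k)
      ... | no  full = f , f-circ , (λ k → ℕ.≮⇒≥ λ f<l → full (k , f<l)) , f≤u
      ... | yes (e , fe<le)
        with f′ , f↝f′ , f′-circ , f′e≡ ← Augment.augment f f-circ e
               (ℚ.<-≤-trans (fromℕ-mono-< fe<le) (l≤g e)) =
        fill f′ (rec less) f′-circ (λ k → ⇝-≤ (g≤u k) (f≤u k) (f↝f′ k))
        where
        -- The drop is strict at `e`: its value rises by one from below `l e`, so the truncated
        -- difference really decreases there.
        less : shortage f′ ℕ.< shortage f
        less = sumℕ-mono-< (λ k → ⇝-∸ (l≤g k) (f↝f′ k)) e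
          (subst (λ n → l e ∸ n ℕ.< l e ∸ f e) (sym f′e≡) (ℕ.∸-monoʳ-< (ℕ.n<1+n (f e)) fe<le))

      integralCirculation : IntegralCirculation
      integralCirculation = fill (const 0) (ℕ.<-wellFounded _)
        (λ π → sum-zero λ k → ℚ.*-zeroˡ (π (head k) - π (tail k))) (λ _ → z≤n)

-- The bipartite double cover

sign : Colour → ℚ
sign red  = 1ℚ
sign blue = - 1ℚ

opposite : Colour → Colour
opposite red  = blue
opposite blue = red

sign-opposite : ∀ c → sign (opposite c) ≡ - sign c
sign-opposite red  = refl
sign-opposite blue = refl

m+m≡2*m : ∀ m → m ℕ.+ m ≡ 2 ℕ.* m
m+m≡2*m m = cong (m ℕ.+_) (sym (ℕ.+-identityʳ m))

module DoubleCover (G : Graph) (𝒞 : Colouring G) where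

  open Graph G using (∣V∣; ∣E∣; end₁; end₂; loopless)

  side : Colour → V G → Fin (∣V∣ ℕ.+ ∣V∣)
  side red  v = v ↑ˡ ∣V∣
  side blue v = ∣V∣ ↑ʳ v

  -- At the red copy of a vertex red edges enter and blue edges leave; at the blue copy it is the
  -- reverse. Conservation at the copies thus mirrors the alternating condition.
  tail head : Fin (∣E∣ ℕ.+ ∣E∣) → Fin (∣V∣ ℕ.+ ∣V∣)
  tail k = [ (λ e → side (opposite (𝒞 e)) (end₁ e))
           , (λ e → side (opposite (𝒞 e)) (end₂ e)) ]′ (splitAt ∣E∣ k)
  head k = [ (λ e → side (𝒞 e) (end₂ e))
           , (λ e → side (𝒞 e) (end₁ e)) ]′ (splitAt ∣E∣ k)

  edge : Fin (∣E∣ ℕ.+ ∣E∣) → E G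
  edge k = [ id , id ]′ (splitAt ∣E∣ k)

  edge-↑ˡ : ∀ e → edge (e ↑ˡ ∣E∣) ≡ e
  edge-↑ˡ e = cong [ id , id ]′ (splitAt-↑ˡ ∣E∣ e ∣E∣)

  edge-↑ʳ : ∀ e → edge (∣E∣ ↑ʳ e) ≡ e
  edge-↑ʳ e = cong [ id , id ]′ (splitAt-↑ʳ ∣E∣ ∣E∣ e)

  open Digraph tail head public

  flow : (Fin (∣E∣ ℕ.+ ∣E∣) → ℚ) → (Fin (∣V∣ ℕ.+ ∣V∣) → ℚ) → E G → ℚ
  flow h π e =
    h (e ↑ˡ ∣E∣) * (π (side (𝒞 e) (end₂ e)) - π (side (opposite (𝒞 e)) (end₁ e))) +
    h (∣E∣ ↑ʳ e) * (π (side (𝒞 e) (end₁ e)) - π (side (opposite (𝒞 e)) (end₂ e)))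

  ⟪⟫-edges : ∀ h π → ⟪ h , π ⟫ ≡ sum (flow h π)
  ⟪⟫-edges h π = begin
    ⟪ h , π ⟫
      ≡⟨ sum-↑ ∣E∣ term ⟩
    sum (λ e → term (e ↑ˡ ∣E∣)) + sum (λ e → term (∣E∣ ↑ʳ e))
      ≡⟨ ∑-distrib-+ (λ e → term (e ↑ˡ ∣E∣)) (λ e → term (∣E∣ ↑ʳ e)) ⟨
    sum (λ e → term (e ↑ˡ ∣E∣) + term (∣E∣ ↑ʳ e))
      ≡⟨ sum-cong-≗ copies ⟩
    sum (flow h π) ∎
    where
    open ≡-Reasoning
    term : Fin (∣E∣ ℕ.+ ∣E∣) → ℚ
    term k = h k * (π (head k) - π (tail k))
    copies : ∀ e → term (e ↑ˡ ∣E∣) + term (∣E∣ ↑ʳ e) ≡ flow h π e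
    copies e rewrite splitAt-↑ˡ ∣E∣ e ∣E∣ | splitAt-↑ʳ ∣E∣ ∣E∣ e = refl

  -- Transpose of the vertex-edge incidence matrix, with each edge signed by its colour. Evaluated
  -- at `δ v` it gives the coefficients of red degree minus blue degree at `v`.
  coboundary : (V G → ℚ) → E G → ℚ
  coboundary ρ e = sign (𝒞 e) * (ρ (end₁ e) + ρ (end₂ e))

  imbalance : (E G → ℚ) → V G → ℚ
  imbalance x v = sum λ e → x e * coboundary (δ v) e

  colourDegree-imbalance : ∀ x v →
    colourDegree G 𝒞 red x v ≡ colourDegree G 𝒞 blue x v + imbalance x v
  colourDegree-imbalance x v = trans (sum-cong-≗ pointwise)
    (∑-distrib-+ (part blue) λ e → x e * coboundary (δ v) e)
    where
    part : Colour → E G → ℚ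
    part c e = if does (Graph.incident? G v e ×-dec (𝒞 e ≟ᶜ c)) then x e else 0ℚ
    pointwise : ∀ e → part red e ≡ part blue e + x e * coboundary (δ v) e
    pointwise e with v ≟ end₁ e | v ≟ end₂ e | 𝒞 e
    -- A loop would count twice in `coboundary` but only once in `colourDegree`.
    ... | yes p | yes q | _    = contradiction (trans (sym p) q) (loopless e)
    ... | yes _ | no _  | red  = solve 1 (λ a → a := con 0ℚ :+ a :* con 1ℚ) refl (x e)
    ... | yes _ | no _  | blue = solve 1 (λ a → con 0ℚ := a :+ a :* con (- 1ℚ)) refl (x e)
    ... | no _  | yes _ | red  = solve 1 (λ a → a := con 0ℚ :+ a :* con 1ℚ) refl (x e)
    ... | no _  | yes _ | blue = solve 1 (λ a → con 0ℚ := a :+ a :* con (- 1ℚ)) refl (x e)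
    ... | no _  | no _  | red  = solve 1 (λ a → con 0ℚ := con 0ℚ :+ a :* con 0ℚ) refl (x e)
    ... | no _  | no _  | blue = solve 1 (λ a → con 0ℚ := con 0ℚ :+ a :* con 0ℚ) refl (x e)

  alternating⇒imbalance≡0 : ∀ {x} → x ∈ AlternatingCone G 𝒞 → ∀ v → imbalance x v ≡ 0ℚ
  alternating⇒imbalance≡0 {x} (_ , red≡blue) v = begin
    imbalance x v            ≡⟨ solve 2 (λ b i → i := (b :+ i) :- b) refl blues (imbalance x v) ⟩
    blues + imbalance x v - blues
      ≡⟨ cong (_- blues) (trans (sym (colourDegree-imbalance x v)) (red≡blue v)) ⟩
    blues - blues            ≡⟨ ℚ.+-inverseʳ blues ⟩
    0ℚ                       ∎
    where
    open ≡-Reasoning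
    blues : ℚ
    blues = colourDegree G 𝒞 blue x v

  -- Adjointness of the signed incidence map and its transpose, by exchanging the two sums.
  ∑-imbalance : ∀ x (ρ : V G → ℚ) → sum (λ v → ρ v * imbalance x v) ≡
    sum λ e → x e * coboundary ρ e
  ∑-imbalance x ρ = begin
    sum (λ v → ρ v * imbalance x v)          ≡⟨ sum-cong-≗ (λ v → *-distribˡ-sum (ρ v) (term v)) ⟩
    sum (λ v → sum λ e → ρ v * term v e)     ≡⟨ ∑-comm (λ v e → ρ v * term v e) ⟩
    sum (λ e → sum λ v → ρ v * term v e)     ≡⟨ sum-cong-≗ collect ⟩
    sum (λ e → x e * coboundary ρ e)         ∎
    where
    open ≡-Reasoning
    term : V G → E G → ℚ
    term v e = x e * coboundary (δ v) e
    collect : ∀ e → sum (λ v → ρ v * term v e) ≡ x e * coboundary ρ e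
    collect e = begin
      sum (λ v → ρ v * term v e)
        ≡⟨ sum-cong-≗ (λ v → solve 5
             (λ r a s d d′ → r :* (a :* (s :* (d :+ d′))) := (a :* s) :* (r :* d :+ r :* d′))
             refl (ρ v) (x e) (sign (𝒞 e)) (δ v (end₁ e)) (δ v (end₂ e))) ⟩
      sum (λ v → x e * sign (𝒞 e) * (ρ v * δ v (end₁ e) + ρ v * δ v (end₂ e)))
        ≡⟨ *-distribˡ-sum (x e * sign (𝒞 e)) (λ v → ρ v * δ v (end₁ e) + ρ v * δ v (end₂ e)) ⟨
      x e * sign (𝒞 e) * sum (λ v → ρ v * δ v (end₁ e) + ρ v * δ v (end₂ e))
        ≡⟨ cong (λ z → x e * sign (𝒞 e) * z)
             (∑-distrib-+ (λ v → ρ v * δ v (end₁ e)) λ v → ρ v * δ v (end₂ e)) ⟩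
      x e * sign (𝒞 e) * (sum (λ v → ρ v * δ v (end₁ e)) + sum (λ v → ρ v * δ v (end₂ e)))
        ≡⟨ cong (λ z → x e * sign (𝒞 e) * z) (cong₂ _+_ (sum-δ ρ (end₁ e)) (sum-δ ρ (end₂ e))) ⟩
      x e * sign (𝒞 e) * (ρ (end₁ e) + ρ (end₂ e))
        ≡⟨ ℚ.*-assoc (x e) _ _ ⟩
      x e * coboundary ρ e ∎

  -- As both arcs over an edge carry the same value, only the difference `ρ` of the potential
  -- between red and blue copies matters, and the pairing becomes a combination of imbalances.
  lift-circulation : ∀ {x} → x ∈ AlternatingCone G 𝒞 → Circulation (x ∘ edge)
  lift-circulation {x} x∈A π = begin
    ⟪ x ∘ edge , π ⟫                  ≡⟨ ⟪⟫-edges (x ∘ edge) π ⟩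
    sum (flow (x ∘ edge) π)           ≡⟨ sum-cong-≗ combine ⟩
    sum (λ e → x e * coboundary ρ e)  ≡⟨ ∑-imbalance x ρ ⟨
    sum (λ v → ρ v * imbalance x v)
      ≡⟨ sum-zero (λ v → trans (cong (ρ v *_) (alternating⇒imbalance≡0 x∈A v)) (ℚ.*-zeroʳ (ρ v))) ⟩
    0ℚ                                ∎
    where
    open ≡-Reasoning
    ρ : V G → ℚ
    ρ v = π (side red v) - π (side blue v)
    combine : ∀ e → flow (x ∘ edge) π e ≡ x e * coboundary ρ e
    combine e rewrite edge-↑ˡ e | edge-↑ʳ e with 𝒞 e
    ... | red  = solve 5
      (λ a r₁ b₁ r₂ b₂ → a :* (r₂ :- b₁) :+ a :* (r₁ :- b₂)
        := a :* (con 1ℚ :* ((r₁ :- b₁) :+ (r₂ :- b₂)))) refl (x e)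
      (π (side red (end₁ e))) (π (side blue (end₁ e)))
      (π (side red (end₂ e))) (π (side blue (end₂ e)))
    ... | blue = solve 5
      (λ a r₁ b₁ r₂ b₂ → a :* (b₂ :- r₁) :+ a :* (b₁ :- r₂)
        := a :* (con (- 1ℚ) :* ((r₁ :- b₁) :+ (r₂ :- b₂)))) refl (x e)
      (π (side red (end₁ e))) (π (side blue (end₁ e)))
      (π (side red (end₂ e))) (π (side blue (end₂ e)))

  -- From integral circulations to integral alternating vectors

  project : (Fin (∣E∣ ℕ.+ ∣E∣) → ℕ) → E G → ℕ
  project f e = f (e ↑ˡ ∣E∣) ℕ.+ f (∣E∣ ↑ʳ e)

  project-alternating : ∀ f → Circulation (fromℕ ∘ f) → fromℕ ∘ project f ∈ AlternatingCone G 𝒞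
  project-alternating f f-circ = (λ e → fromℕ-mono-≤ {n = project f e} z≤n) , λ v → begin
    colourDegree G 𝒞 red y v
      ≡⟨ colourDegree-imbalance y v ⟩
    colourDegree G 𝒞 blue y v + imbalance y v
      ≡⟨ cong (λ z → colourDegree G 𝒞 blue y v + z) (balanced v) ⟩
    colourDegree G 𝒞 blue y v + 0ℚ
      ≡⟨ ℚ.+-identityʳ _ ⟩
    colourDegree G 𝒞 blue y v ∎
    where
    open ≡-Reasoning
    y : E G → ℚ
    y = fromℕ ∘ project f

    -- The indicator of the red copy of `v` minus that of the blue copy. Both arcs over an edge then
    -- get the same coefficient `coboundary (δ v) e`, so only the sum of their values enters.
    potential : V G → Fin (∣V∣ ℕ.+ ∣V∣) → ℚ
    potential v k = [ δ v , -_ ∘ δ v ]′ (splitAt ∣V∣ k)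

    potential-side : ∀ v c w → potential v (side c w) ≡ sign c * δ v w
    potential-side v red  w rewrite splitAt-↑ˡ ∣V∣ w ∣V∣ = sym (ℚ.*-identityˡ (δ v w))
    potential-side v blue w rewrite splitAt-↑ʳ ∣V∣ ∣V∣ w =
      solve 1 (λ d → :- d := con (- 1ℚ) :* d) refl (δ v w)

    potential-opposite : ∀ v c w → potential v (side (opposite c) w) ≡ - sign c * δ v w
    potential-opposite v c w =
      trans (potential-side v (opposite c) w) (cong (_* δ v w) (sign-opposite c))

    balanced : ∀ v → imbalance y v ≡ 0ℚ
    balanced v = begin
      imbalance y v                         ≡⟨ sum-cong-≗ split ⟩
      sum (flow (fromℕ ∘ f) (potential v))  ≡⟨ ⟪⟫-edges (fromℕ ∘ f) (potential v) ⟨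
      ⟪ fromℕ ∘ f , potential v ⟫           ≡⟨ f-circ (potential v) ⟩
      0ℚ                                    ∎
      where
      split : ∀ e → y e * coboundary (δ v) e ≡ flow (fromℕ ∘ f) (potential v) e
      split e
        rewrite fromℕ-+ (f (e ↑ˡ ∣E∣)) (f (∣E∣ ↑ʳ e))
              | potential-side v (𝒞 e) (end₁ e) | potential-side v (𝒞 e) (end₂ e)
              | potential-opposite v (𝒞 e) (end₁ e) | potential-opposite v (𝒞 e) (end₂ e) =
        solve 5
          (λ a b s d₁ d₂ → (a :+ b) :* (s :* (d₁ :+ d₂)) :=
            a :* (s :* d₂ :- :- s :* d₁) :+ b :* (s :* d₁ :- :- s :* d₂)) refl
          (fromℕ (f (e ↑ˡ ∣E∣))) (fromℕ (f (∣E∣ ↑ʳ e))) (sign (𝒞 e)) (δ v (end₁ e)) (δ v (end₂ e))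

  rounded-lift : ∀ (l u : E G → ℕ) {x} → x ∈ AlternatingCone G 𝒞 →
    (∀ e → fromℕ (l e) ≤ x e × x e ≤ fromℕ (u e)) →
    ∃ λ f → Circulation (fromℕ ∘ f) ×
      (∀ k → l (edge k) ℕ.≤ f k) × (∀ k → f k ℕ.≤ u (edge k))
  rounded-lift l u {x} x∈A l≤x≤u =
    Rounding.integralCirculation (x ∘ edge) (proj₁ x∈A ∘ edge) (lift-circulation x∈A)
      (l ∘ edge) (u ∘ edge) (proj₁ ∘ l≤x≤u ∘ edge) (proj₂ ∘ l≤x≤u ∘ edge)

  project-≥ : ∀ (l : E G → ℕ) f → (∀ k → l (edge k) ℕ.≤ f k) →
    ∀ e → 2 ℕ.* l e ℕ.≤ project f e
  project-≥ l f l≤f e = subst (ℕ._≤ project f e) (m+m≡2*m (l e)) (ℕ.+-mono-≤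
    (subst (λ e′ → l e′ ℕ.≤ f (e ↑ˡ ∣E∣)) (edge-↑ˡ e) (l≤f (e ↑ˡ ∣E∣)))
    (subst (λ e′ → l e′ ℕ.≤ f (∣E∣ ↑ʳ e)) (edge-↑ʳ e) (l≤f (∣E∣ ↑ʳ e))))

  project-≤ : ∀ (u : E G → ℕ) f → (∀ k → f k ℕ.≤ u (edge k)) →
    ∀ e → project f e ℕ.≤ 2 ℕ.* u e
  project-≤ u f f≤u e = subst (project f e ℕ.≤_) (m+m≡2*m (u e)) (ℕ.+-mono-≤
    (subst (λ e′ → f (e ↑ˡ ∣E∣) ℕ.≤ u e′) (edge-↑ˡ e) (f≤u (e ↑ˡ ∣E∣)))
    (subst (λ e′ → f (∣E∣ ↑ʳ e) ℕ.≤ u e′) (edge-↑ʳ e) (f≤u (∣E∣ ↑ʳ e))))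

theorem3p1 : (G : Graph) (𝒞 : Colouring G) (l u : E G → ℕ) →
    (∀ e → l e ℕ.≤ u e) →
    (∃ λ (x : E G → ℚ) → x ∈ AlternatingCone G 𝒞 ×
    (∀ e → fromℕ (l e) ≤ x e × x e ≤ fromℕ (u e))) →
    ∃ λ (y : E G → ℚ) → y ∈ AlternatingCone G 𝒞 × Integral y ×
    (∀ e → fromℕ (2 ℕ.* l e) ≤ y e × y e ≤ fromℕ (2 ℕ.* u e))
theorem3p1 G 𝒞 l u _ (x , x∈A , l≤x≤u) =
  fromℕ ∘ project f , project-alternating f f-circ ,
  -- `fromℕ n` unfolds to `+ n / 1`, so integrality holds by definition.
  (λ e → ℤ.+ project f e , refl) ,
  (λ e → fromℕ-mono-≤ (project-≥ l f l≤f e) , fromℕ-mono-≤ (project-≤ u f f≤u e))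
  where
  open DoubleCover G 𝒞
  lift = rounded-lift l u x∈A l≤x≤u
  f = proj₁ lift
  f-circ = proj₁ (proj₂ lift)
  l≤f = proj₁ (proj₂ (proj₂ lift))
  f≤u = proj₂ (proj₂ (proj₂ lift))
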